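{- Let $p\ge2$ and $m\ge0$ be integers. Then \begin{align*} &(-1)^{p-1}\{S(2,p+2m+1;p)+S(2,p;p+2m+1)\}\\ &=\sum_{i=1}^{p+2m}\sum_{j=1}^{p+2m+1-i}(-1)^{i+j}\zeta(p+2m+3-i-j)S(p;i+j)-\sum_{i=1}^{p-1}\sum_{j=1}^{p-i}(-1)^{i+j}\zeta(p+2-i-j)S(p+2m+1;i+j)\\ &\quad-(-1)^p\zeta(2)\{\zeta(p)\zeta(p+2m+1)+\zeta(2p+2m+1)\}\\ &\quad+(-1)^p(p+2m+1)S(1,p;p+2m+2)+(-1)^p p\,S(1,p+2m+1;p+1). \end{align*}
   Context: For positive integers $k,n$, $\zeta_n(k)=\sum_{j=1}^n j^{ -k}$, $H_n=\zeta_n(1)$, and $\zeta(s)=\sum_{n\ge1}n^{ -s}$. For positive integers $a,b,q$ with $q\ge2$: $S(a;q)=\sum_{n\ge1}\zeta_n(a)n^{ -q}$ and $S(a,b;q)=\sum_{n\ge1}\zeta_n(a)\zeta_n(b)n^{ -q}$. -}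

module Defs where

open import Data.Nat as ℕ using (ℕ; zero; suc; _∸_)
open import Data.Nat.Properties using (m^n≢0)
open import Data.Integer using (ℤ; +_)
open import Data.Rational using (ℚ; 0ℚ; 1ℚ; _+_; _*_; _-_; -_; _/_)

invPow : ℕ → ℕ → ℚ
invPow j k = _/_ (+ 1) (suc j ℕ.^ k) {{m^n≢0 (suc j) k}}

sumFrom1 : ℕ → (ℕ → ℚ) → ℚ
sumFrom1 zero    f = 0ℚ
sumFrom1 (suc N) f = sumFrom1 N f + f (suc N)

-- n^{-k} for n ≥ 1 (the value at n = 0 is never used)
npow : ℕ → ℕ → ℚ
npow zero    k = 0ℚ
npow (suc j) k = invPow j k

zetaN : ℕ → ℕ → ℚ
zetaN n k = sumFrom1 n (λ j → npow j k)

zetaT : ℕ → ℕ → ℚ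
zetaT N s = zetaN N s

S1T : ℕ → ℕ → ℕ → ℚ
S1T N a q = sumFrom1 N (λ n → zetaN n a * npow n q)

S2T : ℕ → ℕ → ℕ → ℕ → ℚ
S2T N a b q = sumFrom1 N (λ n → zetaN n a * zetaN n b * npow n q)

sgn : ℕ → ℚ
sgn zero    = 1ℚ
sgn (suc k) = - sgn k

lhsT : ℕ → ℕ → ℕ → ℚ
lhsT p m N =
  sgn (p ∸ 1) * (S2T N 2 (p ℕ.+ 2 ℕ.* m ℕ.+ 1) p + S2T N 2 p (p ℕ.+ 2 ℕ.* m ℕ.+ 1))

-- Truncated RHS (every series ζ(·), S(·;·), S(·,·;·) replaced by its N-th partial sum)
rhsT : ℕ → ℕ → ℕ → ℚ
rhsT p m N =
  let w = p ℕ.+ 2 ℕ.* m ℕ.+ 1 in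
    sumFrom1 (w ∸ 1) (λ i → sumFrom1 (w ∸ i) (λ j →
      sgn (i ℕ.+ j) * (zetaT N (w ℕ.+ 2 ∸ i ∸ j) * S1T N p (i ℕ.+ j))))
  - sumFrom1 (p ∸ 1) (λ i → sumFrom1 (p ∸ i) (λ j →
      sgn (i ℕ.+ j) * (zetaT N (p ℕ.+ 2 ∸ i ∸ j) * S1T N w (i ℕ.+ j))))
  - sgn p * zetaT N 2 * (zetaT N p * zetaT N w + zetaT N (p ℕ.+ w))
  + sgn p * ((+ w) / 1) * S2T N 1 p (w ℕ.+ 1)
  + sgn p * ((+ p) / 1) * S2T N 1 w (p ℕ.+ 1)

{-# OPTIONS --safe #-}
-- Expand 1 / (kᵇ (n+k)²) in partial fractions in k and sum over k and n with weight ζₙ(a).  This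
-- expresses T(a,b) = Σ ζₙ(a) k⁻ᵇ (n+k)⁻² through the double sum Σ (-1)ⁱ⁺ʲ ζ(b+2-i-j) S(a;i+j) and
-- S(1,a;b+1), S(a;b), S(2,a;b).  Substituting n = j + l shows T(a,b) = Σ j⁻ᵃ k⁻ᵇ (j+k+l)⁻² over
-- j, k ≥ 1 and l ≥ 0, which is symmetric in a and b; T(p,w) = T(w,p) with w = p+2m+1 is the theorem,
-- after S(p;w) + S(w;p) = ζ(p)ζ(w) + ζ(p+w).  The truncated version of each step is an exact
-- identity with error terms that are at most 4/N.
module Submission where

open import Defs
open import Data.Nat using (ℕ; _≤_)
open import Data.Product using (∃-syntax)
open import Data.Rational using (ℚ; 0ℚ; _<_; _-_; ∣_∣)

open import Data.Nat as ℕ using (zero; suc; _∸_; s≤s; z≤n)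
import Data.Nat.Properties as ℕ
open import Data.Integer as ℤ using (+_; +[1+_]; -[1+_])
import Data.Integer.Properties as ℤ
open import Data.Rational as ℚ using (1ℚ; _+_; _*_; -_; _/_; mkℚ; toℚᵘ)
open import Data.Rational.Properties
open import Data.Rational.Unnormalised as ℚᵘ using (mkℚᵘ; *≡*; *<*)
import Data.Rational.Unnormalised.Properties as ℚᵘ
open import Data.Product using (_,_)
open import Data.Sum using (inj₁; inj₂)
open import Relation.Binary.PropositionalEquality
open import Relation.Nullary.Decidable using (dec⇒maybe)
open import Tactic.RingSolver using (solve-∀)
open import Tactic.RingSolver.Core.AlmostCommutativeRing using (AlmostCommutativeRing; fromCommutativeRing)

ℚ-ring : AlmostCommutativeRing _ _
ℚ-ring = fromCommutativeRing +-*-commutativeRing (λ x → dec⇒maybe (0ℚ ≟ x))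

-- Arithmetic of fractions

ι : ℕ → ℚ
ι n = + n / 1

-- Normalisation hides numerators and denominators; in the unnormalised rationals the product is
-- componentwise, so the identity is transported through `toℚᵘ`.
/-*-/ : ∀ i j m n .{{_ : ℕ.NonZero m}} .{{_ : ℕ.NonZero n}} .{{_ : ℕ.NonZero (m ℕ.* n)}} →
  (i / m) * (j / n) ≡ (i ℤ.* j) / (m ℕ.* n)
/-*-/ i j (suc m) (suc n) = toℚᵘ-injective (begin
  toℚᵘ ((i / suc m) * (j / suc n))
    ≈⟨ toℚᵘ-homo-* (i / suc m) (j / suc n) ⟩
  toℚᵘ (i / suc m) ℚᵘ.* toℚᵘ (j / suc n)
    ≈⟨ ℚᵘ.*-cong (toℚᵘ-fromℚᵘ (mkℚᵘ i m)) (toℚᵘ-fromℚᵘ (mkℚᵘ j n)) ⟩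
  mkℚᵘ i m ℚᵘ.* mkℚᵘ j n
    ≈⟨ ℚᵘ.≃-sym (toℚᵘ-fromℚᵘ (mkℚᵘ i m ℚᵘ.* mkℚᵘ j n)) ⟩
  toℚᵘ ((i ℤ.* j) / (suc m ℕ.* suc n)) ∎)
  where open ℚᵘ.≃-Reasoning

ι-+ : ∀ m n → ι (m ℕ.+ n) ≡ ι m + ι n
ι-+ m n = toℚᵘ-injective (begin
  toℚᵘ (ι (m ℕ.+ n))
    ≈⟨ toℚᵘ-fromℚᵘ (mkℚᵘ (+ (m ℕ.+ n)) 0) ⟩
  mkℚᵘ (+ (m ℕ.+ n)) 0
    ≈⟨ *≡* (cong (ℤ._* + 1) (sym (cong₂ ℤ._+_ (ℤ.*-identityʳ (+ m)) (ℤ.*-identityʳ (+ n))))) ⟩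
  mkℚᵘ (+ m) 0 ℚᵘ.+ mkℚᵘ (+ n) 0
    ≈⟨ ℚᵘ.+-cong (ℚᵘ.≃-sym (toℚᵘ-fromℚᵘ (mkℚᵘ (+ m) 0))) (ℚᵘ.≃-sym (toℚᵘ-fromℚᵘ (mkℚᵘ (+ n) 0))) ⟩
  toℚᵘ (ι m) ℚᵘ.+ toℚᵘ (ι n)
    ≈⟨ ℚᵘ.≃-sym (toℚᵘ-homo-+ (ι m) (ι n)) ⟩
  toℚᵘ (ι m + ι n) ∎)
  where open ℚᵘ.≃-Reasoning

ι-suc : ∀ n → ι (suc n) ≡ ι n + 1ℚ
ι-suc n = trans (cong ι (ℕ.+-comm 1 n)) (ι-+ n 1)

0≤i/n : ∀ i n .{{_ : ℕ.NonZero n}} → 0ℚ ℚ.≤ + i / n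
0≤i/n i n = nonNegative⁻¹ (+ i / n) {{normalize-nonNeg i n}}

n/n≡1 : ∀ n .{{_ : ℕ.NonZero n}} → + n / n ≡ 1ℚ
n/n≡1 (suc n) = toℚᵘ-injective (ℚᵘ.≃-trans (toℚᵘ-fromℚᵘ (mkℚᵘ (+ suc n) n))
  (*≡* (ℤ.*-comm (+ suc n) (+ 1))))

ι*npow : ∀ C n → ι C * npow (suc n) 1 ≡ + C / suc n
ι*npow C n = trans (/-*-/ (+ C) (+ 1) 1 (suc n ℕ.^ 1) {{_}} {{n^1≢0}} {{1*n^1≢0}})
  (/-cong {{1*n^1≢0}} (ℤ.*-identityʳ (+ C)) (trans (ℕ.*-identityˡ _) (ℕ.*-identityʳ _)))
  where
  n^1≢0 = ℕ.m^n≢0 (suc n) 1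
  1*n^1≢0 = ℕ.m*n≢0 1 (suc n ℕ.^ 1) {{_}} {{n^1≢0}}

ι-inverseʳ : ∀ n → ι (suc n) * npow (suc n) 1 ≡ 1ℚ
ι-inverseʳ n = trans (ι*npow (suc n) n) (n/n≡1 (suc n))

-- With ε = (a+1)/(d+1), the inequality C/(n+1) < ε cross-multiplies to C(d+1) < (a+1)(n+1), which
-- follows from C(d+1) ≤ n. Hence the witness `C * suc d`.
archimedean : ∀ C ε → 0ℚ < ε → ∃[ N₀ ] ∀ n → N₀ ≤ n → ι C * npow (suc n) 1 < ε
archimedean C ε@(mkℚ +[1+ a ] d _) 0<ε = C ℕ.* suc d , λ n C*d≤n →
  subst (_< ε) (sym (ι*npow C n)) (toℚᵘ-cancel-< (ℚᵘ.<-respˡ-≃ (ℚᵘ.≃-sym (toℚᵘ-fromℚᵘ (mkℚᵘ (+ C) n)))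
    (*<* (ℤ.<-≤-trans {+ C ℤ.* + suc d} {+ suc n} (subst (ℤ._< + suc n) (ℤ.pos-* C (suc d)) (ℤ.+<+ (s≤s C*d≤n)))
      (ℤ.≤-trans (ℤ.+≤+ (ℕ.m≤n*m (suc n) (suc a))) (ℤ.≤-reflexive (ℤ.pos-* (suc a) (suc n))))))))
archimedean C (mkℚ (+ 0) d _) 0<ε with ℚ.positive 0<ε
... | ()
archimedean C (mkℚ -[1+ a ] d _) 0<ε with ℚ.positive 0<ε
... | ()

-- Reciprocal powers

npow-+ : ∀ n a b → npow n (a ℕ.+ b) ≡ npow n a * npow n b
npow-+ zero a b = refl
npow-+ (suc j) a b = sym (trans (/-*-/ (+ 1) (+ 1) (suc j ℕ.^ a) (suc j ℕ.^ b) {{na}} {{nb}} {{nn}})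
  (/-cong {p₁ = + 1} {{nn}} {{ℕ.m^n≢0 (suc j) (a ℕ.+ b)}} refl (sym (ℕ.^-distribˡ-+-* (suc j) a b))))
  where
  na = ℕ.m^n≢0 (suc j) a
  nb = ℕ.m^n≢0 (suc j) b
  nn = ℕ.m*n≢0 (suc j ℕ.^ a) (suc j ℕ.^ b) {{na}} {{nb}}

npow-suc : ∀ n k → npow n (suc k) ≡ npow n 1 * npow n k
npow-suc n k = npow-+ n 1 k

npow-+1 : ∀ n k → npow n (k ℕ.+ 1) ≡ npow n k * npow n 1
npow-+1 n k = npow-+ n k 1

0≤npow : ∀ n k → 0ℚ ℚ.≤ npow n k
0≤npow zero    k = ≤-refl
0≤npow (suc j) k = 0≤i/n 1 (suc j ℕ.^ k) {{ℕ.m^n≢0 (suc j) k}}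

-- The relation 1/(k(n+k)) = (1/n)(1/k - 1/(n+k)) is all that the partial fractions need.
npow-sum : ∀ n k → npow (suc k) 1 * npow (suc n ℕ.+ suc k) 1
  ≡ npow (suc n) 1 * (npow (suc k) 1 - npow (suc n ℕ.+ suc k) 1)
npow-sum n k = begin
  -- Division is replaced by a polynomial identity: `lem₁` inserts `N * y`, `(N + K) * z` and
  -- `K * x`, each of which equals 1; once they are replaced, the first summand vanishes.
  x * z                                     ≡⟨ lem₁ N K x y z ⟩
  (1ℚ - N * y) * (x * z) + y * ((N + K) * z) * x - K * x * y * z
    ≡⟨ cong₂ (λ u v → (1ℚ - N * y) * (x * z) + y * u * x - v * y * z) nk*z (ι-inverseʳ k) ⟩
  (1ℚ - N * y) * (x * z) + y * 1ℚ * x - 1ℚ * y * z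
    ≡⟨ cong (λ u → (1ℚ - u) * (x * z) + y * 1ℚ * x - 1ℚ * y * z) (ι-inverseʳ n) ⟩
  (1ℚ - 1ℚ) * (x * z) + y * 1ℚ * x - 1ℚ * y * z ≡⟨ lem₂ x y z ⟩
  y * (x - z) ∎
  where
  open ≡-Reasoning
  n′ = suc n
  k′ = suc k
  N = ι n′
  K = ι k′
  x = npow k′ 1
  y = npow n′ 1
  z = npow (n′ ℕ.+ k′) 1
  nk*z : (N + K) * z ≡ 1ℚ
  nk*z = trans (cong (_* z) (sym (ι-+ n′ k′))) (ι-inverseʳ (n ℕ.+ k′))
  lem₁ : ∀ N K x y z → x * z ≡ (1ℚ - N * y) * (x * z) + y * ((N + K) * z) * x - K * x * y * z
  lem₁ = solve-∀ ℚ-ring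
  lem₂ : ∀ x y z → (1ℚ - 1ℚ) * (x * z) + y * 1ℚ * x - 1ℚ * y * z ≡ y * (x - z)
  lem₂ = solve-∀ ℚ-ring

-- Finite sums

-- Sums start at 1, so agreement is asked only at arguments `suc i`, away from the default value of
-- `npow` at 0.
sum-cong : ∀ N {f g} → (∀ i → i ℕ.< N → f (suc i) ≡ g (suc i)) → sumFrom1 N f ≡ sumFrom1 N g
sum-cong zero    eq = refl
sum-cong (suc N) eq = cong₂ _+_ (sum-cong N (λ i i<N → eq i (ℕ.m<n⇒m<1+n i<N))) (eq N ℕ.≤-refl)

sum-+ : ∀ N f g → sumFrom1 N (λ i → f i + g i) ≡ sumFrom1 N f + sumFrom1 N g
sum-+ zero    f g = refl
sum-+ (suc N) f g = trans (cong (_+ (f (suc N) + g (suc N))) (sum-+ N f g)) (lem (sumFrom1 N f) (sumFrom1 N g) (f (suc N)) (g (suc N)))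
  where
  lem : ∀ a b c d → (a + b) + (c + d) ≡ (a + c) + (b + d)
  lem = solve-∀ ℚ-ring

sum-*ˡ : ∀ N c f → sumFrom1 N (λ i → c * f i) ≡ c * sumFrom1 N f
sum-*ˡ zero    c f = sym (*-zeroʳ c)
sum-*ˡ (suc N) c f = trans (cong (_+ c * f (suc N)) (sum-*ˡ N c f)) (sym (*-distribˡ-+ c _ _))

sum-*ʳ : ∀ N c f → sumFrom1 N (λ i → f i * c) ≡ sumFrom1 N f * c
sum-*ʳ N c f = trans (sum-cong N (λ i _ → *-comm (f (suc i)) c)) (trans (sum-*ˡ N c f) (*-comm c _))

sum-- : ∀ N f g → sumFrom1 N (λ i → f i - g i) ≡ sumFrom1 N f - sumFrom1 N g
sum-- zero    f g = refl
sum-- (suc N) f g = trans (cong (_+ (f (suc N) - g (suc N))) (sum-- N f g)) (lem (sumFrom1 N f) (sumFrom1 N g) (f (suc N)) (g (suc N)))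
  where
  lem : ∀ a b c d → (a - b) + (c - d) ≡ (a + c) - (b + d)
  lem = solve-∀ ℚ-ring

sum-0 : ∀ N → sumFrom1 N (λ _ → 0ℚ) ≡ 0ℚ
sum-0 zero    = refl
sum-0 (suc N) = trans (+-identityʳ _) (sum-0 N)

sum-const : ∀ N c → sumFrom1 N (λ _ → c) ≡ ι N * c
sum-const zero    c = sym (*-zeroˡ c)
sum-const (suc N) c = trans (cong (_+ c) (sum-const N c))
  (trans (lem (ι N) c) (cong (_* c) (sym (ι-suc N))))
  where
  lem : ∀ n c → n * c + c ≡ (n + 1ℚ) * c
  lem = solve-∀ ℚ-ring

sum-swap : ∀ M N (f : ℕ → ℕ → ℚ) →
  sumFrom1 M (λ i → sumFrom1 N (λ j → f i j)) ≡ sumFrom1 N (λ j → sumFrom1 M (λ i → f i j))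
sum-swap zero    N f = sym (sum-0 N)
sum-swap (suc M) N f = trans (cong (_+ sumFrom1 N (f (suc M))) (sum-swap M N f))
  (sym (sum-+ N (λ j → sumFrom1 M (λ i → f i j)) (f (suc M))))

sum-append : ∀ M N f → sumFrom1 (M ℕ.+ N) f ≡ sumFrom1 M f + sumFrom1 N (λ k → f (M ℕ.+ k))
sum-append M zero    f = trans (cong (λ K → sumFrom1 K f) (ℕ.+-identityʳ M)) (sym (+-identityʳ _))
sum-append M (suc N) f = trans (cong (λ K → sumFrom1 K f) (ℕ.+-suc M N))
  (trans (cong₂ _+_ (sum-append M N f) (cong f (sym (ℕ.+-suc M N)))) (+-assoc (sumFrom1 M f) _ _))

sum-mono : ∀ N {f g} → (∀ i → i ℕ.< N → f (suc i) ℚ.≤ g (suc i)) → sumFrom1 N f ℚ.≤ sumFrom1 N g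
sum-mono zero    f≤g = ≤-refl
sum-mono (suc N) f≤g = +-mono-≤ (sum-mono N (λ i i<N → f≤g i (ℕ.m<n⇒m<1+n i<N))) (f≤g N ℕ.≤-refl)

∣sum∣≤sum∣∣ : ∀ N f → ∣ sumFrom1 N f ∣ ℚ.≤ sumFrom1 N (λ i → ∣ f i ∣)
∣sum∣≤sum∣∣ zero    f = ≤-refl
∣sum∣≤sum∣∣ (suc N) f =
  ≤-trans (∣p+q∣≤∣p∣+∣q∣ (sumFrom1 N f) (f (suc N))) (+-monoˡ-≤ _ (∣sum∣≤sum∣∣ N f))

-- Both sides sum f(j)g(n) over j ≤ n ≤ N. Collecting by j leaves the sum of g from j to N, a
-- difference of partial sums.
abel-summation : ∀ N f g → sumFrom1 N (λ n → sumFrom1 n f * g n)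
  ≡ sumFrom1 N (λ j → f j * (sumFrom1 N g - sumFrom1 (j ∸ 1) g))
abel-summation zero    f g = refl
abel-summation (suc N) f g = begin
  sumFrom1 N (λ n → sumFrom1 n f * g n) + (F + f′) * g′
    ≡⟨ cong (_+ (F + f′) * g′) (abel-summation N f g) ⟩
  A + (F + f′) * g′
    ≡⟨ lem₁ A F G f′ g′ ⟩
  A + F * g′ + f′ * (G + g′ - G)
    ≡⟨ cong (λ u → A + u + f′ * (G + g′ - G)) (sym (sum-*ʳ N g′ f)) ⟩
  A + sumFrom1 N (λ j → f j * g′) + f′ * (G + g′ - G)
    ≡⟨ cong (_+ f′ * (G + g′ - G)) (sym (sum-+ N _ _)) ⟩
  sumFrom1 N (λ j → f j * (G - sumFrom1 (j ∸ 1) g) + f j * g′) + f′ * (G + g′ - G)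
    ≡⟨ cong (_+ f′ * (G + g′ - G)) (sum-cong N (λ i _ → lem₂ (f (suc i)) G (sumFrom1 i g) g′)) ⟩
  sumFrom1 N (λ j → f j * (G + g′ - sumFrom1 (j ∸ 1) g)) + f′ * (G + g′ - G) ∎
  where
  open ≡-Reasoning
  F = sumFrom1 N f
  G = sumFrom1 N g
  A = sumFrom1 N (λ j → f j * (G - sumFrom1 (j ∸ 1) g))
  f′ = f (suc N)
  g′ = g (suc N)
  lem₁ : ∀ A F G f′ g′ → A + (F + f′) * g′ ≡ A + F * g′ + f′ * (G + g′ - G)
  lem₁ = solve-∀ ℚ-ring
  lem₂ : ∀ f G h g′ → f * (G - h) + f * g′ ≡ f * (G + g′ - h)
  lem₂ = solve-∀ ℚ-ring

-- There are s - 1 pairs i, j ≥ 1 with i + j = s. In the induction, passing from v to v + 1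
-- lengthens each row i ≤ v by one entry on the diagonal i + j = v + 1, which adds v copies of
-- h(v+1).
sum-triangle : ∀ w (h : ℕ → ℚ) →
  sumFrom1 (w ∸ 1) (λ i → sumFrom1 (w ∸ i) (λ j → h (i ℕ.+ j))) ≡ sumFrom1 w (λ s → ι (s ∸ 1) * h s)
sum-triangle zero    h = refl
sum-triangle (suc v) h = begin
  sumFrom1 v (λ i → sumFrom1 (suc v ∸ i) (λ j → h (i ℕ.+ j)))
    ≡⟨ sum-cong v diagonal ⟩
  sumFrom1 v (λ i → row v i + h (suc v))
    ≡⟨ sum-+ v (row v) (λ _ → h (suc v)) ⟩
  sumFrom1 v (row v) + sumFrom1 v (λ _ → h (suc v))
    -- Row v of the smaller triangle has length v - v = 0; dropping it gives the range of the
    -- induction hypothesis.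
    ≡⟨ cong₂ _+_ (last-row-empty v) (sum-const v (h (suc v))) ⟩
  sumFrom1 (v ∸ 1) (row v) + ι v * h (suc v)
    ≡⟨ cong (_+ ι v * h (suc v)) (sum-triangle v h) ⟩
  sumFrom1 v (λ s → ι (s ∸ 1) * h s) + ι v * h (suc v) ∎
  where
  open ≡-Reasoning
  row : ℕ → ℕ → ℚ
  row v i = sumFrom1 (v ∸ i) (λ j → h (i ℕ.+ j))
  diagonal : ∀ i → i ℕ.< v → row (suc v) (suc i) ≡ row v (suc i) + h (suc v)
  diagonal i i<v = trans (cong (λ K → sumFrom1 K (λ j → h (suc i ℕ.+ j))) (ℕ.+-∸-assoc 1 i<v))
    (cong (λ K → row v (suc i) + h K) (trans (ℕ.+-suc (suc i) (v ∸ suc i)) (cong suc (ℕ.m+[n∸m]≡n i<v))))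
  last-row-empty : ∀ v → sumFrom1 v (row v) ≡ sumFrom1 (v ∸ 1) (row v)
  last-row-empty zero    = refl
  last-row-empty (suc u) = trans
    (cong (λ K → sumFrom1 u (row (suc u)) + sumFrom1 K (λ j → h (suc u ℕ.+ j))) (ℕ.n∸n≡0 u))
    (+-identityʳ _)

-- Partial fractions

-- Induction on b, multiplying by x = 1/k. With y = 1/n and z = 1/(n+k), products xz are traded for
-- y(x - z). The term in b(x - z) leaves behind b x² y^(b+1), the new summand s = b + 1, and the
-- term in z² yields one more copy of x - z, raising b to b + 1. In the sum k has exponent at least
-- 2, so only x - z needs its two parts kept together for convergence in k.
partial-fractions : ∀ b n k → npow (suc k) b * npow (suc n ℕ.+ suc k) 2
  ≡ sumFrom1 b (λ s → ι (s ∸ 1) * (sgn s * (npow (suc k) (b ℕ.+ 2 ∸ s) * npow (suc n) s)))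
    - sgn b * ι b * npow (suc n) (b ℕ.+ 1) * (npow (suc k) 1 - npow (suc n ℕ.+ suc k) 1)
    + sgn b * npow (suc n) b * npow (suc n ℕ.+ suc k) 2
partial-fractions zero n k = lem (npow (suc n) 1) (npow (suc k) 1 - npow (suc n ℕ.+ suc k) 1) (npow (suc n ℕ.+ suc k) 2)
  where
  lem : ∀ y d z → 1ℚ * z ≡ 0ℚ - 1ℚ * 0ℚ * y * d + 1ℚ * 1ℚ * z
  lem = solve-∀ ℚ-ring
partial-fractions (suc b) n k = begin
  npow k′ (suc b) * z₂
    ≡⟨ cong (_* z₂) (npow-suc k′ b) ⟩
  x * npow k′ b * z₂
    ≡⟨ *-assoc x (npow k′ b) z₂ ⟩
  x * (npow k′ b * z₂)
    ≡⟨ cong (x *_) (partial-fractions b n k) ⟩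
  x * (Σb - σ * ι b * npow n′ (b ℕ.+ 1) * (x - z) + σ * yᵇ * z₂)
    ≡⟨ cong₂ (λ u v → x * (Σb - σ * ι b * u * (x - z) + σ * yᵇ * v)) (npow-+1 n′ b) (npow-suc (n′ ℕ.+ k′) 1) ⟩
  x * (Σb - σ * ι b * (yᵇ * y) * (x - z) + σ * yᵇ * (z * z))
    ≡⟨ lem₁ x y z Σb σ (ι b) yᵇ ⟩
  x * Σb - σ * ι b * (yᵇ * y) * (x * x - x * z) + σ * yᵇ * (x * z * z)
    ≡⟨ cong (λ u → x * Σb - σ * ι b * (yᵇ * y) * (x * x - u) + σ * yᵇ * (u * z)) (npow-sum n k) ⟩
  x * Σb - σ * ι b * (yᵇ * y) * (x * x - y * (x - z)) + σ * yᵇ * (y * (x - z) * z)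
    ≡⟨ lem₂ x y z Σb σ (ι b) yᵇ ⟩
  x * Σb + ι b * (- σ * (x * x * (y * yᵇ))) + - σ * yᵇ * (y * (y * (x - z) - x * z))
    - - σ * (ι b + 1ℚ) * (y * yᵇ * y) * (x - z) + - σ * (y * yᵇ) * (z * z)
    -- The term in z² has produced another xz; `lem₂` set it against y(x - z) in a correction
    -- bracket, which the same relation turns into zero.
    ≡⟨ cong (λ u → x * Σb + ι b * (- σ * (x * x * (y * yᵇ))) + - σ * yᵇ * (y * (y * (x - z) - u))
       - - σ * (ι b + 1ℚ) * (y * yᵇ * y) * (x - z) + - σ * (y * yᵇ) * (z * z)) (npow-sum n k) ⟩
  x * Σb + ι b * (- σ * (x * x * (y * yᵇ))) + - σ * yᵇ * (y * (y * (x - z) - y * (x - z)))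
    - - σ * (ι b + 1ℚ) * (y * yᵇ * y) * (x - z) + - σ * (y * yᵇ) * (z * z)
    ≡⟨ lem₃ x y z Σb σ (ι b) yᵇ ⟩
  x * Σb + ι b * (- σ * (x * x * (y * yᵇ)))
    - - σ * (ι b + 1ℚ) * (y * yᵇ * y) * (x - z) + - σ * (y * yᵇ) * (z * z)
    ≡⟨ cong₂ (λ u v → x * Σb + ι b * (- σ * (x * x * v)) - - σ * u * (v * y) * (x - z) + - σ * v * (z * z))
       (sym (ι-suc b)) (sym (npow-suc n′ b)) ⟩
  x * Σb + ι b * (- σ * (x * x * yˢ)) - - σ * ι (suc b) * (yˢ * y) * (x - z) + - σ * yˢ * (z * z)
    ≡⟨ cong₂ (λ u v → x * Σb + ι b * (- σ * (x * x * yˢ)) - - σ * ι (suc b) * u * (x - z) + - σ * yˢ * v)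
       (sym (npow-+1 n′ (suc b))) (sym (npow-suc (n′ ℕ.+ k′) 1)) ⟩
  x * Σb + ι b * (- σ * (x * x * yˢ)) - - σ * ι (suc b) * npow n′ (suc b ℕ.+ 1) * (x - z) + - σ * yˢ * z₂
    ≡⟨ cong (λ u → u - - σ * ι (suc b) * npow n′ (suc b ℕ.+ 1) * (x - z) + - σ * yˢ * z₂)
       (cong₂ _+_ shift (cong (λ u → ι b * (- σ * (u * yˢ))) x²)) ⟩
  sumFrom1 (suc b) (term (suc b)) - - σ * ι (suc b) * npow n′ (suc b ℕ.+ 1) * (x - z) + - σ * yˢ * z₂ ∎
  where
  open ≡-Reasoning
  n′ = suc n
  k′ = suc k
  x = npow k′ 1
  y = npow n′ 1
  z = npow (n′ ℕ.+ k′) 1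
  z₂ = npow (n′ ℕ.+ k′) 2
  yᵇ = npow n′ b
  yˢ = npow n′ (suc b)
  σ = sgn b
  term : ℕ → ℕ → ℚ
  term b s = ι (s ∸ 1) * (sgn s * (npow k′ (b ℕ.+ 2 ∸ s) * npow n′ s))
  Σb = sumFrom1 b (term b)
  x² : x * x ≡ npow k′ (suc b ℕ.+ 2 ∸ suc b)
  x² = trans (sym (npow-suc k′ 1)) (cong (npow k′) (sym (ℕ.m+n∸m≡n b 2)))
  -- One more power of 1/k turns the exponent b + 2 - s into b + 3 - s; since `∸` truncates, this
  -- uses s ≤ b + 2.
  shift : x * Σb ≡ sumFrom1 b (term (suc b))
  shift = trans (sym (sum-*ˡ b x (term b))) (sum-cong b (λ i i<b →
    trans (lem₀ x (ι i) (sgn (suc i)) (npow k′ (b ℕ.+ 2 ∸ suc i)) (npow n′ (suc i)))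
    (cong (λ u → ι i * (sgn (suc i) * (u * npow n′ (suc i))))
      (trans (sym (npow-suc k′ (b ℕ.+ 2 ∸ suc i)))
        (cong (npow k′) (sym (ℕ.+-∸-assoc 1 (ℕ.≤-trans i<b (ℕ.m≤m+n b 2)))))))))
    where
    lem₀ : ∀ x i s u v → x * (i * (s * (u * v))) ≡ i * (s * (x * u * v))
    lem₀ = solve-∀ ℚ-ring
  lem₁ : ∀ x y z S σ B q → x * (S - σ * B * (q * y) * (x - z) + σ * q * (z * z))
    ≡ x * S - σ * B * (q * y) * (x * x - x * z) + σ * q * (x * z * z)
  lem₁ = solve-∀ ℚ-ring
  lem₂ : ∀ x y z S σ B q → x * S - σ * B * (q * y) * (x * x - y * (x - z)) + σ * q * (y * (x - z) * z)
    ≡ x * S + B * (- σ * (x * x * (y * q))) + - σ * q * (y * (y * (x - z) - x * z))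
    - - σ * (B + 1ℚ) * (y * q * y) * (x - z) + - σ * (y * q) * (z * z)
  lem₂ = solve-∀ ℚ-ring
  lem₃ : ∀ x y z S σ B q → x * S + B * (- σ * (x * x * (y * q))) + - σ * q * (y * (y * (x - z) - y * (x - z)))
    - - σ * (B + 1ℚ) * (y * q * y) * (x - z) + - σ * (y * q) * (z * z)
    ≡ x * S + B * (- σ * (x * x * (y * q)))
    - - σ * (B + 1ℚ) * (y * q * y) * (x - z) + - σ * (y * q) * (z * z)
  lem₃ = solve-∀ ℚ-ring

-- Truncated sums

tail : ℕ → ℕ → ℕ → ℚ
tail N n s = sumFrom1 n (λ k → npow (N ℕ.+ k) s)

zetaN-+ : ∀ N n s → zetaN (N ℕ.+ n) s ≡ zetaN N s + tail N n s
zetaN-+ N n s = sum-append N n (λ j → npow j s)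

-- Both sides are the partial sum up to N + n, cut once at n and once at N. This trades a block
-- starting after n for a block starting after the cutoff N.
tail-comm : ∀ N n s → zetaN n s + tail n N s ≡ zetaN N s + tail N n s
tail-comm N n s = trans (sym (zetaN-+ n N s)) (trans (cong (λ K → zetaN K s) (ℕ.+-comm n N)) (zetaN-+ N n s))

-- T(a,b) truncated to the square n, k ≤ N. The factor (n+k)⁻² reaches up to 2N, which is where
-- blocks beyond N come from.
T : ℕ → ℕ → ℕ → ℚ
T N a b = sumFrom1 N (λ n → zetaN n a * sumFrom1 N (λ k → npow k b * npow (n ℕ.+ k) 2))

-- In the sum of 1/k - 1/(n+k) the harmonic divergence cancels, leaving ζₙ(1) minus a block beyond
-- N. Likewise the sum of (n+k)⁻² is ζ_N(2) - ζₙ(2) plus such a block.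
inner-sum : ∀ N b n → sumFrom1 N (λ k → npow k b * npow (suc n ℕ.+ k) 2)
  ≡ sumFrom1 b (λ s → ι (s ∸ 1) * (sgn s * (zetaN N (b ℕ.+ 2 ∸ s) * npow (suc n) s)))
    - sgn b * ι b * npow (suc n) (b ℕ.+ 1) * (zetaN (suc n) 1 - tail N (suc n) 1)
    + sgn b * npow (suc n) b * (zetaN N 2 - zetaN (suc n) 2 + tail N (suc n) 2)
inner-sum N b n = begin
  sumFrom1 N (λ k → npow k b * npow (n′ ℕ.+ k) 2)
    ≡⟨ sum-cong N (λ k _ → partial-fractions b n k) ⟩
  sumFrom1 N (λ k → sumFrom1 b (term k) - c₁ * (npow k 1 - npow (n′ ℕ.+ k) 1) + c₂ * npow (n′ ℕ.+ k) 2)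
    ≡⟨ sum-+ N _ _ ⟩
  sumFrom1 N (λ k → sumFrom1 b (term k) - c₁ * (npow k 1 - npow (n′ ℕ.+ k) 1))
    + sumFrom1 N (λ k → c₂ * npow (n′ ℕ.+ k) 2)
    ≡⟨ cong₂ _+_ (sum-- N _ _) (sum-*ˡ N c₂ (λ k → npow (n′ ℕ.+ k) 2)) ⟩
  sumFrom1 N (λ k → sumFrom1 b (term k)) - sumFrom1 N (λ k → c₁ * (npow k 1 - npow (n′ ℕ.+ k) 1))
    + c₂ * tail n′ N 2
    ≡⟨ cong₂ (λ u v → u - v + c₂ * tail n′ N 2) first (trans (sum-*ˡ N c₁ _) (cong (c₁ *_) (sum-- N _ _))) ⟩
  S - c₁ * (zetaN N 1 - tail n′ N 1) + c₂ * tail n′ N 2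
    ≡⟨ cong₂ (λ u v → S - c₁ * u + c₂ * v)
       (lem₁ (zetaN N 1) (tail n′ N 1) (zetaN n′ 1) (tail N n′ 1) (tail-comm N n′ 1))
       (lem₂ (zetaN N 2) (tail n′ N 2) (zetaN n′ 2) (tail N n′ 2) (tail-comm N n′ 2)) ⟩
  S - c₁ * (zetaN n′ 1 - tail N n′ 1) + c₂ * (zetaN N 2 - zetaN n′ 2 + tail N n′ 2) ∎
  where
  open ≡-Reasoning
  n′ = suc n
  c₁ = sgn b * ι b * npow n′ (b ℕ.+ 1)
  c₂ = sgn b * npow n′ b
  term : ℕ → ℕ → ℚ
  term k s = ι (s ∸ 1) * (sgn s * (npow k (b ℕ.+ 2 ∸ s) * npow n′ s))
  S = sumFrom1 b (λ s → ι (s ∸ 1) * (sgn s * (zetaN N (b ℕ.+ 2 ∸ s) * npow n′ s)))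
  first : sumFrom1 N (λ k → sumFrom1 b (term k)) ≡ S
  first = trans (sum-swap N b term) (sum-cong b (λ i _ →
    trans (sum-*ˡ N (ι i) _) (cong (ι i *_)
    (trans (sum-*ˡ N (sgn (suc i)) _) (cong (sgn (suc i) *_)
    (sum-*ʳ N (npow n′ (suc i)) (λ k → npow k (b ℕ.+ 2 ∸ suc i))))))))
  lem₁ : ∀ Z t z T → z + t ≡ Z + T → Z - t ≡ z - T
  lem₁ Z t z T eq = trans (l Z t T) (trans (cong (_- (t + T)) (sym eq)) (r t z T))
    where
    l : ∀ Z t T → Z - t ≡ Z + T - (t + T)
    l = solve-∀ ℚ-ring
    r : ∀ t z T → z + t - (t + T) ≡ z - T
    r = solve-∀ ℚ-ring
  lem₂ : ∀ Z t z T → z + t ≡ Z + T → t ≡ Z - z + T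
  lem₂ Z t z T eq = trans (l t z) (trans (cong (_- z) eq) (r Z z T))
    where
    l : ∀ t z → t ≡ z + t - z
    l = solve-∀ ℚ-ring
    r : ∀ Z z T → Z + T - z ≡ Z - z + T
    r = solve-∀ ℚ-ring

-- Evaluation of the truncated T(a,b), with its error terms

E₁ : ℕ → ℕ → ℕ → ℚ
E₁ N a b = sumFrom1 N (λ n → zetaN n a * (npow n (b ℕ.+ 1) * tail N n 1))

E₂ : ℕ → ℕ → ℕ → ℚ
E₂ N a b = sumFrom1 N (λ n → zetaN n a * (npow n b * tail N n 2))

-- The double sum of the theorem, with its i + j = s terms (s - 1 of them) collected.
zetaS : ℕ → ℕ → ℕ → ℚ
zetaS N a b = sumFrom1 b (λ s → ι (s ∸ 1) * (sgn s * (zetaN N (b ℕ.+ 2 ∸ s) * S1T N a s)))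

-- `inner-sum` is weighted by ζₙ(a) and summed over n; the blocks of order 1 and 2 beyond N collect
-- in `E₁` and `E₂`.
T-evaluation : ∀ N a b → T N a b
  ≡ zetaS N a b - sgn b * ι b * (S2T N 1 a (b ℕ.+ 1) - E₁ N a b)
    + sgn b * (zetaN N 2 * S1T N a b - S2T N 2 a b + E₂ N a b)
T-evaluation N a b = begin
  T N a b
    ≡⟨ sum-cong N (λ n _ → trans (cong (zetaN (suc n) a *_) (inner-sum N b n))
         (lem (zetaN (suc n) a) (S (suc n)) (sgn b) (ι b) (npow (suc n) (b ℕ.+ 1)) (zetaN (suc n) 1)
           (tail N (suc n) 1) (npow (suc n) b) (zetaN N 2) (zetaN (suc n) 2) (tail N (suc n) 2))) ⟩
  sumFrom1 N (λ n → zetaN n a * S n - sgn b * ι b * (s₁ n - e₁ n) + sgn b * (zetaN N 2 * t n - s₂ n + e₂ n))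
    ≡⟨ sum-+ N _ _ ⟩
  sumFrom1 N (λ n → zetaN n a * S n - sgn b * ι b * (s₁ n - e₁ n))
    + sumFrom1 N (λ n → sgn b * (zetaN N 2 * t n - s₂ n + e₂ n))
    ≡⟨ cong₂ _+_ (sum-- N _ _) (sum-*ˡ N (sgn b) _) ⟩
  sumFrom1 N (λ n → zetaN n a * S n) - sumFrom1 N (λ n → sgn b * ι b * (s₁ n - e₁ n))
    + sgn b * sumFrom1 N (λ n → zetaN N 2 * t n - s₂ n + e₂ n)
    ≡⟨ cong₂ _+_ (cong₂ _-_ first (trans (sum-*ˡ N (sgn b * ι b) _) (cong (sgn b * ι b *_) (sum-- N s₁ e₁))))
       (cong (sgn b *_) (trans (sum-+ N _ _) (cong (_+ E₂ N a b) (trans (sum-- N _ _)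
         (cong (_- S2T N 2 a b) (sum-*ˡ N (zetaN N 2) t)))))) ⟩
  zetaS N a b - sgn b * ι b * (S2T N 1 a (b ℕ.+ 1) - E₁ N a b)
    + sgn b * (zetaN N 2 * S1T N a b - S2T N 2 a b + E₂ N a b) ∎
  where
  open ≡-Reasoning
  S s₁ s₂ e₁ e₂ t : ℕ → ℚ
  S n = sumFrom1 b (λ s → ι (s ∸ 1) * (sgn s * (zetaN N (b ℕ.+ 2 ∸ s) * npow n s)))
  s₁ n = zetaN n 1 * zetaN n a * npow n (b ℕ.+ 1)
  s₂ n = zetaN n 2 * zetaN n a * npow n b
  e₁ n = zetaN n a * (npow n (b ℕ.+ 1) * tail N n 1)
  e₂ n = zetaN n a * (npow n b * tail N n 2)
  t n = zetaN n a * npow n b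
  lem : ∀ h S σ B u z₁ t₁ v Z z₂ t₂ → h * (S - σ * B * u * (z₁ - t₁) + σ * v * (Z - z₂ + t₂))
    ≡ h * S - σ * B * (z₁ * h * u - h * (u * t₁)) + σ * (Z * (h * v) - z₂ * h * v + h * (v * t₂))
  lem = solve-∀ ℚ-ring
  lem′ : ∀ h i σ Z u → h * (i * (σ * (Z * u))) ≡ i * (σ * (Z * (h * u)))
  lem′ = solve-∀ ℚ-ring
  first : sumFrom1 N (λ n → zetaN n a * S n) ≡ zetaS N a b
  first = trans (sum-cong N (λ n _ → sym (sum-*ˡ b (zetaN (suc n) a) _)))
    (trans (sum-swap N b (λ n s → zetaN n a * (ι (s ∸ 1) * (sgn s * (zetaN N (b ℕ.+ 2 ∸ s) * npow n s)))))
    (sum-cong b (λ i _ → trans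
      (sum-cong N (λ n _ → lem′ (zetaN (suc n) a) (ι i) (sgn (suc i)) (zetaN N (b ℕ.+ 2 ∸ suc i)) (npow (suc n) (suc i))))
      (trans (sum-*ˡ N (ι i) _) (cong (ι i *_)
      (trans (sum-*ˡ N (sgn (suc i)) _) (cong (sgn (suc i) *_)
      (sum-*ˡ N (zetaN N (b ℕ.+ 2 ∸ suc i)) (λ n → zetaN n a * npow n (suc i))))))))))

-- The finite form of n = j + l: for fixed k, Abel summation unfolds ζₙ(a) and leaves the sum of
-- (n+k)⁻² for n from j to N. Its lower end depends on j + k only; the upper end k + N alone breaks
-- the symmetry.
T-by-parts : ∀ N a b → T N a b ≡ sumFrom1 N (λ k → sumFrom1 N (λ j →
  npow k b * (npow j a * (zetaN (k ℕ.+ N) 2 - zetaN (k ℕ.+ (j ∸ 1)) 2))))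
T-by-parts N a b = begin
  T N a b
    ≡⟨ sum-cong N (λ n _ → trans (sym (sum-*ˡ N (zetaN (suc n) a) _)) (sum-cong N (λ k _ →
         lem (zetaN (suc n) a) (npow (suc k) b) (npow (suc n ℕ.+ suc k) 2)))) ⟩
  sumFrom1 N (λ n → sumFrom1 N (λ k → npow k b * (zetaN n a * npow (n ℕ.+ k) 2)))
    ≡⟨ sum-swap N N (λ n k → npow k b * (zetaN n a * npow (n ℕ.+ k) 2)) ⟩
  sumFrom1 N (λ k → sumFrom1 N (λ n → npow k b * (zetaN n a * npow (n ℕ.+ k) 2)))
    ≡⟨ sum-cong N (λ k _ → trans (sum-*ˡ N (npow (suc k) b) _)
         (trans (cong (npow (suc k) b *_) (trans
           (abel-summation N (λ j → npow j a) (λ n → npow (n ℕ.+ suc k) 2))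
           (sum-cong N (λ j _ → cong (npow (suc j) a *_) (difference (suc k) N j)))))
         (sym (sum-*ˡ N (npow (suc k) b) _)))) ⟩
  sumFrom1 N (λ k → sumFrom1 N (λ j → npow k b * (npow j a * (zetaN (k ℕ.+ N) 2 - zetaN (k ℕ.+ (j ∸ 1)) 2)))) ∎
  where
  open ≡-Reasoning
  lem : ∀ h u v → h * (u * v) ≡ u * (h * v)
  lem = solve-∀ ℚ-ring
  lem′ : ∀ z A B → A - B ≡ (z + A) - (z + B)
  lem′ = solve-∀ ℚ-ring
  flip-tail : ∀ k M → sumFrom1 M (λ n → npow (n ℕ.+ k) 2) ≡ tail k M 2
  flip-tail k M = sum-cong M (λ n _ → cong (λ K → npow K 2) (ℕ.+-comm (suc n) k))
  difference : ∀ k M L → sumFrom1 M (λ n → npow (n ℕ.+ k) 2) - sumFrom1 L (λ n → npow (n ℕ.+ k) 2)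
    ≡ zetaN (k ℕ.+ M) 2 - zetaN (k ℕ.+ L) 2
  difference k M L = trans (cong₂ _-_ (flip-tail k M) (flip-tail k L))
    (trans (lem′ (zetaN k 2) (tail k M 2) (tail k L 2)) (sym (cong₂ _-_ (zetaN-+ k M 2) (zetaN-+ k L 2))))

-- Once j and k are exchanged in one of the sums, the weights and the terms at j + k - 1 agree. What
-- survives is ζ_{j+N}(2) - ζ_{k+N}(2), where ζ_N(2) cancels.
T-asymmetry : ∀ N a b → T N b a - T N a b
  ≡ sumFrom1 N (λ k → sumFrom1 N (λ j → npow k b * (npow j a * (tail N j 2 - tail N k 2))))
T-asymmetry N a b = begin
  T N b a - T N a b
    ≡⟨ cong₂ _-_ (trans (T-by-parts N b a) (sum-swap N N (λ k j → term k j a b))) (T-by-parts N a b) ⟩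
  sumFrom1 N (λ k → sumFrom1 N (λ j → term j k a b)) - sumFrom1 N (λ k → sumFrom1 N (λ j → term k j b a))
    ≡⟨ sym (sum-- N _ _) ⟩
  sumFrom1 N (λ k → sumFrom1 N (λ j → term j k a b) - sumFrom1 N (λ j → term k j b a))
    ≡⟨ sum-cong N (λ k _ → trans (sym (sum-- N _ _)) (sum-cong N (λ j _ → pointwise j k))) ⟩
  sumFrom1 N (λ k → sumFrom1 N (λ j → npow k b * (npow j a * (tail N j 2 - tail N k 2)))) ∎
  where
  open ≡-Reasoning
  term : ℕ → ℕ → ℕ → ℕ → ℚ
  term k j b a = npow k b * (npow j a * (zetaN (k ℕ.+ N) 2 - zetaN (k ℕ.+ (j ∸ 1)) 2))
  zeta-tail : ∀ k → zetaN (k ℕ.+ N) 2 ≡ zetaN N 2 + tail N k 2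
  zeta-tail k = trans (cong (λ K → zetaN K 2) (ℕ.+-comm k N)) (zetaN-+ N k 2)
  lem : ∀ u v Z s t c → u * (v * (Z + s - c)) - v * (u * (Z + t - c)) ≡ v * (u * (s - t))
  lem = solve-∀ ℚ-ring
  pointwise : ∀ j k → term (suc j) (suc k) a b - term (suc k) (suc j) b a
    ≡ npow (suc k) b * (npow (suc j) a * (tail N (suc j) 2 - tail N (suc k) 2))
  pointwise j k = trans
    (cong₂ (λ u v → npow (suc j) a * (npow (suc k) b * u) - npow (suc k) b * (npow (suc j) a * v))
      (cong₂ _-_ (zeta-tail (suc j)) (cong (λ K → zetaN (suc K) 2) (ℕ.+-comm j k)))
      (cong (_- zetaN (suc k ℕ.+ j) 2) (zeta-tail (suc k))))
    (lem (npow (suc j) a) (npow (suc k) b) (zetaN N 2) (tail N (suc j) 2) (tail N (suc k) 2) (zetaN (suc k ℕ.+ j) 2))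

-- The regions j ≤ n and n ≤ j cover the square of side N and count its diagonal twice.
S1T-reflection : ∀ N a b → S1T N a b + S1T N b a ≡ zetaN N a * zetaN N b + zetaN N (a ℕ.+ b)
S1T-reflection zero    a b = refl
S1T-reflection (suc N) a b = begin
  (S1T N a b + (A + u) * v) + (S1T N b a + (B + v) * u)
    ≡⟨ lem₁ (S1T N a b) (S1T N b a) A B u v ⟩
  (S1T N a b + S1T N b a) + ((A + u) * v + (B + v) * u)
    ≡⟨ cong (_+ ((A + u) * v + (B + v) * u)) (S1T-reflection N a b) ⟩
  (A * B + zetaN N (a ℕ.+ b)) + ((A + u) * v + (B + v) * u)
    ≡⟨ lem₂ A B u v (zetaN N (a ℕ.+ b)) ⟩
  (A + u) * (B + v) + (zetaN N (a ℕ.+ b) + u * v)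
    ≡⟨ cong (λ q → (A + u) * (B + v) + (zetaN N (a ℕ.+ b) + q)) (sym (npow-+ (suc N) a b)) ⟩
  (A + u) * (B + v) + (zetaN N (a ℕ.+ b) + npow (suc N) (a ℕ.+ b)) ∎
  where
  open ≡-Reasoning
  A = zetaN N a
  B = zetaN N b
  u = npow (suc N) a
  v = npow (suc N) b
  lem₁ : ∀ s t A B u v → (s + (A + u) * v) + (t + (B + v) * u) ≡ (s + t) + ((A + u) * v + (B + v) * u)
  lem₁ = solve-∀ ℚ-ring
  lem₂ : ∀ A B u v z → (A * B + z) + ((A + u) * v + (B + v) * u) ≡ (A + u) * (B + v) + (z + u * v)
  lem₂ = solve-∀ ℚ-ring

-- Signs and the exact error of the truncated identity

sgn-+ : ∀ a b → sgn (a ℕ.+ b) ≡ sgn a * sgn b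
sgn-+ zero    b = sym (*-identityˡ (sgn b))
sgn-+ (suc a) b = trans (cong -_ (sgn-+ a b)) (neg-distribˡ-* (sgn a) (sgn b))

sgn*sgn : ∀ a → sgn a * sgn a ≡ 1ℚ
sgn*sgn zero    = refl
sgn*sgn (suc a) = trans (lem (sgn a)) (sgn*sgn a)
  where
  lem : ∀ x → - x * - x ≡ x * x
  lem = solve-∀ ℚ-ring

-- The shift 2m + 1 is odd. Because of this, the terms of T(a,b) carrying the sign (-1)ᵇ add up in
-- T(w,p) - T(p,w), so that S(p;w) + S(w;p) appears and the reflection applies.
sgn-odd-shift : ∀ p m → sgn (p ℕ.+ 2 ℕ.* m ℕ.+ 1) ≡ - sgn p
sgn-odd-shift p m = begin
  sgn (p ℕ.+ 2 ℕ.* m ℕ.+ 1)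
    ≡⟨ cong sgn (ℕ.+-comm (p ℕ.+ 2 ℕ.* m) 1) ⟩
  - sgn (p ℕ.+ 2 ℕ.* m)
    ≡⟨ cong -_ (sgn-+ p (2 ℕ.* m)) ⟩
  - (sgn p * sgn (m ℕ.+ (m ℕ.+ 0)))
    ≡⟨ cong (λ k → - (sgn p * sgn (m ℕ.+ k))) (ℕ.+-identityʳ m) ⟩
  - (sgn p * sgn (m ℕ.+ m))
    ≡⟨ cong (λ q → - (sgn p * q)) (trans (sgn-+ m m) (sgn*sgn m)) ⟩
  - (sgn p * 1ℚ)
    ≡⟨ cong -_ (*-identityʳ (sgn p)) ⟩
  - sgn p ∎
  where open ≡-Reasoning

∣sgn∣ : ∀ k → ∣ sgn k ∣ ≡ 1ℚ
∣sgn∣ zero    = refl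
∣sgn∣ (suc k) = trans (∣-p∣≡∣p∣ (sgn k)) (∣sgn∣ k)

error-formula : ∀ p m N → 2 ≤ p → let w = p ℕ.+ 2 ℕ.* m ℕ.+ 1 in
  lhsT p m N - rhsT p m N
  ≡ (T N w p - T N p w) - sgn p * ((ι w * E₁ N p w + ι p * E₁ N w p) + (E₂ N p w + E₂ N w p))
-- With p a successor, `sgn p` reduces to `- sgn p-1`, so that `lem` handles all signs through the
-- single α = (-1)^(p-1).
error-formula p@(suc p-1) m N _ = begin
  lhsT p m N - rhsT p m N
    ≡⟨ cong₂ (λ F G → sgn p-1 * (S2T N 2 w p + S2T N 2 p w)
         - (F - G - sgn p * zetaN N 2 * (zetaN N p * zetaN N w + zetaN N (p ℕ.+ w))
           + sgn p * ι w * S2T N 1 p (w ℕ.+ 1) + sgn p * ι p * S2T N 1 w (p ℕ.+ 1)))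
       (double-sum p w) (double-sum w p) ⟩
  sgn p-1 * (S2T N 2 w p + S2T N 2 p w)
    - (zetaS N p w - zetaS N w p - sgn p * zetaN N 2 * (zetaN N p * zetaN N w + zetaN N (p ℕ.+ w))
      + sgn p * ι w * S2T N 1 p (w ℕ.+ 1) + sgn p * ι p * S2T N 1 w (p ℕ.+ 1))
    ≡⟨ cong (λ u → sgn p-1 * (S2T N 2 w p + S2T N 2 p w)
         - (zetaS N p w - zetaS N w p - sgn p * zetaN N 2 * u
           + sgn p * ι w * S2T N 1 p (w ℕ.+ 1) + sgn p * ι p * S2T N 1 w (p ℕ.+ 1)))
       (sym (S1T-reflection N p w)) ⟩
  sgn p-1 * (S2T N 2 w p + S2T N 2 p w)
    - (zetaS N p w - zetaS N w p - sgn p * zetaN N 2 * (S1T N p w + S1T N w p)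
      + sgn p * ι w * S2T N 1 p (w ℕ.+ 1) + sgn p * ι p * S2T N 1 w (p ℕ.+ 1))
    ≡⟨ lem (sgn p-1) (zetaS N p w) (zetaS N w p) (zetaN N 2) (S1T N p w) (S1T N w p) (ι w) (ι p)
         (S2T N 1 p (w ℕ.+ 1)) (S2T N 1 w (p ℕ.+ 1)) (S2T N 2 p w) (S2T N 2 w p)
         (E₁ N p w) (E₁ N w p) (E₂ N p w) (E₂ N w p) ⟩
  (evaluated w p (sgn p) - evaluated p w (- sgn p))
    - sgn p * ((ι w * E₁ N p w + ι p * E₁ N w p) + (E₂ N p w + E₂ N w p))
    ≡⟨ cong₂ (λ A B → A - B - sgn p * ((ι w * E₁ N p w + ι p * E₁ N w p) + (E₂ N p w + E₂ N w p)))
       (sym (T-evaluation N w p))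
       (sym (trans (T-evaluation N p w) (cong (evaluated p w) (sgn-odd-shift p m)))) ⟩
  (T N w p - T N p w) - sgn p * ((ι w * E₁ N p w + ι p * E₁ N w p) + (E₂ N p w + E₂ N w p)) ∎
  where
  open ≡-Reasoning
  w = p ℕ.+ 2 ℕ.* m ℕ.+ 1
  double-sum : ∀ a b → sumFrom1 (b ∸ 1) (λ i → sumFrom1 (b ∸ i) (λ j →
      sgn (i ℕ.+ j) * (zetaT N (b ℕ.+ 2 ∸ i ∸ j) * S1T N a (i ℕ.+ j)))) ≡ zetaS N a b
  double-sum a b = trans
    (sum-cong (b ∸ 1) (λ i _ → sum-cong (b ∸ suc i) (λ j _ →
      cong (λ e → sgn (suc i ℕ.+ suc j) * (zetaN N e * S1T N a (suc i ℕ.+ suc j)))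
        -- With b + 2 - i - j written as b + 2 - (i + j), the summand depends on i + j only.
        (ℕ.∸-+-assoc (b ℕ.+ 2) (suc i) (suc j)))))
    (sum-triangle b (λ s → sgn s * (zetaN N (b ℕ.+ 2 ∸ s) * S1T N a s)))
  evaluated : ℕ → ℕ → ℚ → ℚ
  evaluated a b σ = zetaS N a b - σ * ι b * (S2T N 1 a (b ℕ.+ 1) - E₁ N a b)
    + σ * (zetaN N 2 * S1T N a b - S2T N 2 a b + E₂ N a b)
  lem : ∀ α F G Z S S′ W P A A′ Q Q′ e e′ f f′ →
    α * (Q′ + Q) - (F - G - - α * Z * (S + S′) + - α * W * A + - α * P * A′)
    ≡ (G - - α * P * (A′ - e′) + - α * (Z * S′ - Q′ + f′) - (F - - - α * W * (A - e) + - - α * (Z * S - Q + f)))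
      - - α * ((W * e + P * e′) + (f + f′))
  lem = solve-∀ ℚ-ring

-- Bounds

*-monoˡ : ∀ {p q r} → 0ℚ ℚ.≤ r → p ℚ.≤ q → r * p ℚ.≤ r * q
*-monoˡ {r = r} 0≤r = *-monoˡ-≤-nonNeg r {{ℚ.nonNegative 0≤r}}

*-monoʳ : ∀ {p q r} → 0ℚ ℚ.≤ r → p ℚ.≤ q → p * r ℚ.≤ q * r
*-monoʳ {r = r} 0≤r = *-monoʳ-≤-nonNeg r {{ℚ.nonNegative 0≤r}}

0≤* : ∀ {p q} → 0ℚ ℚ.≤ p → 0ℚ ℚ.≤ q → 0ℚ ℚ.≤ p * q
0≤* {p} {q} 0≤p 0≤q = subst (ℚ._≤ p * q) (*-zeroʳ p) (*-monoˡ 0≤p 0≤q)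

0≤sum : ∀ N {f} → (∀ i → 0ℚ ℚ.≤ f i) → 0ℚ ℚ.≤ sumFrom1 N f
0≤sum N {f} 0≤f = subst (ℚ._≤ sumFrom1 N f) (sum-0 N) (sum-mono N (λ i _ → 0≤f (suc i)))

npow-telescope : ∀ n → npow (suc n) 1 * npow (suc (suc n)) 1 ≡ npow (suc n) 1 - npow (suc (suc n)) 1
npow-telescope n = trans (npow-sum 0 n) (*-identityˡ _)

npow-suc-≤ : ∀ n → npow (suc (suc n)) 1 ℚ.≤ npow (suc n) 1
npow-suc-≤ n = subst₂ ℚ._≤_ (+-identityˡ _) (lem (npow (suc n) 1) (npow (suc (suc n)) 1))
  (+-monoˡ-≤ (npow (suc (suc n)) 1)
    (subst (0ℚ ℚ.≤_) (npow-telescope n) (0≤* (0≤npow (suc n) 1) (0≤npow (suc (suc n)) 1))))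
  where
  lem : ∀ x y → x - y + y ≡ x
  lem = solve-∀ ℚ-ring

npow-antitone : ∀ n k → npow (suc n ℕ.+ k) 1 ℚ.≤ npow (suc n) 1
npow-antitone n zero    = ≤-reflexive (cong (λ K → npow (suc K) 1) (ℕ.+-identityʳ n))
npow-antitone n (suc k) = ≤-trans
  (≤-reflexive (cong (λ K → npow (suc K) 1) (ℕ.+-suc n k)))
  (≤-trans (npow-suc-≤ (n ℕ.+ k)) (npow-antitone n k))

npow≤1 : ∀ n k → npow (suc n) k ℚ.≤ 1ℚ
npow≤1 n zero    = ≤-refl
npow≤1 n (suc k) = ≤-trans (≤-reflexive (npow-suc (suc n) k))
  (≤-trans (*-monoˡ (0≤npow (suc n) 1) (npow≤1 n k))
  (≤-trans (≤-reflexive (*-identityʳ _)) (npow-antitone 0 n)))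

npow≤npow2 : ∀ n k → 2 ≤ k → npow (suc n) k ℚ.≤ npow (suc n) 2
npow≤npow2 n (suc (suc k)) (s≤s (s≤s z≤n)) = ≤-trans (≤-reflexive (npow-+ (suc n) 2 k))
  (≤-trans (*-monoˡ (0≤npow (suc n) 2) (npow≤1 n k)) (≤-reflexive (*-identityʳ _)))

-- 1/(n+2)² is at most 1/((n+1)(n+2)), which is a difference of consecutive reciprocals.
npow2-telescope : ∀ n → npow (suc (suc n)) 2 + npow (suc (suc n)) 1 ℚ.≤ npow (suc n) 1
npow2-telescope n = ≤-trans (+-monoˡ-≤ z (≤-trans (≤-reflexive (npow-suc (suc (suc n)) 1))
    (≤-trans (*-monoʳ (0≤npow (suc (suc n)) 1) (npow-suc-≤ n)) (≤-reflexive (npow-telescope n)))))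
  (≤-reflexive (lem (npow (suc n) 1) z))
  where
  z = npow (suc (suc n)) 1
  lem : ∀ x y → x - y + y ≡ x
  lem = solve-∀ ℚ-ring

-- The leftover reciprocal is kept on the left so that the induction can absorb the next square into
-- it. The block starts after `suc N` because `npow 0 1` is 0.
tail2-telescope : ∀ N n → tail (suc N) n 2 + npow (suc N ℕ.+ n) 1 ℚ.≤ npow (suc N) 1
tail2-telescope N zero    = ≤-reflexive (trans (+-identityˡ _) (cong (λ K → npow (suc K) 1) (ℕ.+-identityʳ N)))
tail2-telescope N (suc n) = begin
  tail (suc N) n 2 + npow (suc N ℕ.+ suc n) 2 + npow (suc N ℕ.+ suc n) 1
    ≡⟨ +-assoc (tail (suc N) n 2) _ _ ⟩
  tail (suc N) n 2 + (npow (suc N ℕ.+ suc n) 2 + npow (suc N ℕ.+ suc n) 1)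
    ≡⟨ cong (λ K → tail (suc N) n 2 + (npow (suc K) 2 + npow (suc K) 1)) (ℕ.+-suc N n) ⟩
  tail (suc N) n 2 + (npow (suc (suc (N ℕ.+ n))) 2 + npow (suc (suc (N ℕ.+ n))) 1)
    ≤⟨ +-monoʳ-≤ (tail (suc N) n 2) (npow2-telescope (N ℕ.+ n)) ⟩
  tail (suc N) n 2 + npow (suc N ℕ.+ n) 1
    ≤⟨ tail2-telescope N n ⟩
  npow (suc N) 1 ∎
  where open ≤-Reasoning

0≤tail : ∀ N n s → 0ℚ ℚ.≤ tail N n s
0≤tail N n s = 0≤sum n (λ k → 0≤npow (N ℕ.+ k) s)

tail2≤ : ∀ N n → tail (suc N) n 2 ℚ.≤ npow (suc N) 1
tail2≤ N n = ≤-trans (≤-reflexive (sym (+-identityʳ _)))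
  (≤-trans (+-monoʳ-≤ (tail (suc N) n 2) (0≤npow (suc N ℕ.+ n) 1)) (tail2-telescope N n))

-- The block has n + 1 terms of size at most 1/(N+1), which the factor 1/(n+1) averages. A harmonic
-- block is not uniformly small for n up to the cutoff, so the extra power of n in `E₁` is spent
-- here.
npow*tail1≤ : ∀ N n → npow (suc n) 1 * tail (suc N) (suc n) 1 ℚ.≤ npow (suc N) 1
npow*tail1≤ N n = begin
  npow (suc n) 1 * tail (suc N) (suc n) 1
    ≤⟨ *-monoˡ (0≤npow (suc n) 1) (sum-mono (suc n) (λ k _ → npow-antitone N (suc k))) ⟩
  npow (suc n) 1 * sumFrom1 (suc n) (λ _ → npow (suc N) 1)
    ≡⟨ cong (npow (suc n) 1 *_) (sum-const (suc n) (npow (suc N) 1)) ⟩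
  npow (suc n) 1 * (ι (suc n) * npow (suc N) 1)
    ≡⟨ lem (npow (suc n) 1) (ι (suc n)) (npow (suc N) 1) ⟩
  ι (suc n) * npow (suc n) 1 * npow (suc N) 1
    ≡⟨ cong (_* npow (suc N) 1) (ι-inverseʳ n) ⟩
  1ℚ * npow (suc N) 1
    ≡⟨ *-identityˡ _ ⟩
  npow (suc N) 1 ∎
  where
  open ≤-Reasoning
  lem : ∀ x y z → x * (y * z) ≡ y * x * z
  lem = solve-∀ ℚ-ring

-- Uniform bounds for zeta sums and error terms

0≤zetaN : ∀ N s → 0ℚ ℚ.≤ zetaN N s
0≤zetaN N s = 0≤sum N (λ j → 0≤npow j s)

-- By comparison with s = 2: the first term is 1 and the rest, a block starting after 1, is at most
-- 1 by `tail2≤`.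
zetaN≤2 : ∀ N s → 2 ≤ s → zetaN N s ℚ.≤ ι 2
zetaN≤2 zero    s 2≤s = 0≤i/n 2 1
zetaN≤2 (suc N) s 2≤s = ≤-trans (sum-mono (suc N) (λ i _ → npow≤npow2 i s 2≤s))
  (≤-trans (≤-reflexive (zetaN-+ 1 N 2)) (+-monoʳ-≤ (zetaN 1 2) (tail2≤ 0 N)))

∣sum∣≤2* : ∀ N s e (f : ℕ → ℚ) → 2 ≤ s → 0ℚ ℚ.≤ e → (∀ n → ∣ f (suc n) ∣ ℚ.≤ npow (suc n) s * e) →
  ∣ sumFrom1 N f ∣ ℚ.≤ ι 2 * e
∣sum∣≤2* N s e f 2≤s 0≤e bound = begin
  ∣ sumFrom1 N f ∣                 ≤⟨ ∣sum∣≤sum∣∣ N f ⟩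
  sumFrom1 N (λ n → ∣ f n ∣)       ≤⟨ sum-mono N (λ n _ → bound n) ⟩
  sumFrom1 N (λ n → npow n s * e)  ≡⟨ sum-*ʳ N e (λ n → npow n s) ⟩
  zetaN N s * e                    ≤⟨ *-monoʳ 0≤e (zetaN≤2 N s 2≤s) ⟩
  ι 2 * e                          ∎
  where open ≤-Reasoning

0≤2* : ∀ {e} → 0ℚ ℚ.≤ e → 0ℚ ℚ.≤ ι 2 * e
0≤2* = 0≤* (0≤i/n 2 1)

-- One factor 2 bounds ζₙ(a), the other the sum of n⁻ᵇ. Both error terms have this shape.
zeta-weighted-bound : ∀ N a b e (f : ℕ → ℚ) → 2 ≤ a → 2 ≤ b → 0ℚ ℚ.≤ e → (∀ n → 0ℚ ℚ.≤ f (suc n)) →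
  (∀ n → f (suc n) ℚ.≤ npow (suc n) b * e) →
  ∣ sumFrom1 N (λ n → zetaN n a * f n) ∣ ℚ.≤ ι 2 * (ι 2 * e)
zeta-weighted-bound N a b e f 2≤a 2≤b 0≤e 0≤f f≤ =
  ∣sum∣≤2* N b (ι 2 * e) _ 2≤b (0≤2* 0≤e) (λ n → begin
    ∣ zetaN (suc n) a * f (suc n) ∣  ≡⟨ 0≤p⇒∣p∣≡p (0≤* (0≤zetaN (suc n) a) (0≤f n)) ⟩
    zetaN (suc n) a * f (suc n)      ≤⟨ *-monoʳ (0≤f n) (zetaN≤2 (suc n) a 2≤a) ⟩
    ι 2 * f (suc n)                  ≤⟨ *-monoˡ (0≤i/n 2 1) (f≤ n) ⟩
    ι 2 * (npow (suc n) b * e)       ≡⟨ lem (ι 2) (npow (suc n) b) e ⟩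
    npow (suc n) b * (ι 2 * e)       ∎)
  where
  open ≤-Reasoning
  lem : ∀ x y z → x * (y * z) ≡ y * (x * z)
  lem = solve-∀ ℚ-ring

E₁-bound : ∀ N a b → 2 ≤ a → 2 ≤ b → ∣ E₁ (suc N) a b ∣ ℚ.≤ ι 2 * (ι 2 * npow (suc N) 1)
E₁-bound N a b 2≤a 2≤b = zeta-weighted-bound (suc N) a b (npow (suc N) 1)
  (λ n → npow n (b ℕ.+ 1) * tail (suc N) n 1) 2≤a 2≤b (0≤npow (suc N) 1)
  (λ n → 0≤* (0≤npow (suc n) (b ℕ.+ 1)) (0≤tail (suc N) (suc n) 1))
  (λ n → ≤-trans
    (≤-reflexive (trans (cong (_* tail (suc N) (suc n) 1) (npow-+1 (suc n) b)) (*-assoc (npow (suc n) b) _ _)))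
    (*-monoˡ (0≤npow (suc n) b) (npow*tail1≤ N n)))

E₂-bound : ∀ N a b → 2 ≤ a → 2 ≤ b → ∣ E₂ (suc N) a b ∣ ℚ.≤ ι 2 * (ι 2 * npow (suc N) 1)
E₂-bound N a b 2≤a 2≤b = zeta-weighted-bound (suc N) a b (npow (suc N) 1)
  (λ n → npow n b * tail (suc N) n 2) 2≤a 2≤b (0≤npow (suc N) 1)
  (λ n → 0≤* (0≤npow (suc n) b) (0≤tail (suc N) (suc n) 2))
  (λ n → *-monoˡ (0≤npow (suc n) b) (tail2≤ N (suc n)))

∣-∣≤ : ∀ {x y e} → 0ℚ ℚ.≤ x → 0ℚ ℚ.≤ y → x ℚ.≤ e → y ℚ.≤ e → ∣ x - y ∣ ℚ.≤ e
∣-∣≤ {x} {y} {e} 0≤x 0≤y x≤e y≤e with ∣p∣≡p∨∣p∣≡-p (x - y)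
... | inj₁ eq = ≤-trans (≤-reflexive eq) (≤-trans (+-mono-≤ x≤e (neg-antimono-≤ 0≤y)) (≤-reflexive (+-identityʳ e)))
... | inj₂ eq = ≤-trans (≤-reflexive (trans eq (lem x y)))
  (≤-trans (+-mono-≤ y≤e (neg-antimono-≤ 0≤x)) (≤-reflexive (+-identityʳ e)))
  where
  lem : ∀ x y → - (x - y) ≡ y - x
  lem = solve-∀ ℚ-ring

-- Both tails lie between 0 and 1/(N+1), so their difference is at most that in absolute value; the
-- sums of j⁻ᵃ and k⁻ᵇ cost a factor 2 each.
T-asymmetry-bound : ∀ N a b → 2 ≤ a → 2 ≤ b →
  ∣ T (suc N) b a - T (suc N) a b ∣ ℚ.≤ ι 2 * (ι 2 * npow (suc N) 1)
T-asymmetry-bound N a b 2≤a 2≤b = ≤-trans (≤-reflexive (cong ∣_∣ (T-asymmetry (suc N) a b)))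
  (∣sum∣≤2* (suc N) b (ι 2 * r) _ 2≤b (0≤2* (0≤npow (suc N) 1)) (λ k → ≤-trans
    (∣sum∣≤2* (suc N) a (npow (suc k) b * r) _ 2≤a (0≤* (0≤npow (suc k) b) (0≤npow (suc N) 1)) (λ j → begin
      ∣ npow (suc k) b * (npow (suc j) a * d j k) ∣
        ≡⟨ cong ∣_∣ (lem (npow (suc k) b) (npow (suc j) a) (d j k)) ⟩
      ∣ npow (suc j) a * npow (suc k) b * d j k ∣
        ≡⟨ ∣p*q∣≡∣p∣*∣q∣ (npow (suc j) a * npow (suc k) b) (d j k) ⟩
      ∣ npow (suc j) a * npow (suc k) b ∣ * ∣ d j k ∣
        ≡⟨ cong (_* ∣ d j k ∣) (0≤p⇒∣p∣≡p (0≤weight j k)) ⟩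
      npow (suc j) a * npow (suc k) b * ∣ d j k ∣
        ≤⟨ *-monoˡ (0≤weight j k) (∣-∣≤ (0≤tail (suc N) (suc j) 2) (0≤tail (suc N) (suc k) 2)
             (tail2≤ N (suc j)) (tail2≤ N (suc k))) ⟩
      npow (suc j) a * npow (suc k) b * r
        ≡⟨ *-assoc (npow (suc j) a) (npow (suc k) b) r ⟩
      npow (suc j) a * (npow (suc k) b * r) ∎))
    (≤-reflexive (lem′ (ι 2) (npow (suc k) b) r))))
  where
  open ≤-Reasoning
  r = npow (suc N) 1
  d : ℕ → ℕ → ℚ
  d j k = tail (suc N) (suc j) 2 - tail (suc N) (suc k) 2
  0≤weight : ∀ j k → 0ℚ ℚ.≤ npow (suc j) a * npow (suc k) b
  0≤weight j k = 0≤* (0≤npow (suc j) a) (0≤npow (suc k) b)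
  lem : ∀ x y z → x * (y * z) ≡ y * x * z
  lem = solve-∀ ℚ-ring
  lem′ : ∀ x y z → x * (y * z) ≡ y * (x * z)
  lem′ = solve-∀ ℚ-ring

∣ι*∣≤ : ∀ n {x e} → ∣ x ∣ ℚ.≤ e → ∣ ι n * x ∣ ℚ.≤ ι n * e
∣ι*∣≤ n {x} ∣x∣≤e = ≤-trans
  (≤-reflexive (trans (∣p*q∣≡∣p∣*∣q∣ (ι n) x) (cong (_* ∣ x ∣) (0≤p⇒∣p∣≡p (0≤i/n n 1)))))
  (*-monoˡ (0≤i/n n 1) ∣x∣≤e)

∣+∣≤ : ∀ {x y d e} → ∣ x ∣ ℚ.≤ d → ∣ y ∣ ℚ.≤ e → ∣ x + y ∣ ℚ.≤ d + e
∣+∣≤ {x} {y} ∣x∣≤d ∣y∣≤e = ≤-trans (∣p+q∣≤∣p∣+∣q∣ x y) (+-mono-≤ ∣x∣≤d ∣y∣≤e)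

-- The constant counts bounds of 4/(N+1): one for the asymmetry of T, w and p for the two `E₁`, and
-- one for each of the two `E₂`.
error-bound : ∀ p m N → 2 ≤ p → let w = p ℕ.+ 2 ℕ.* m ℕ.+ 1 in
  ∣ lhsT p m (suc N) - rhsT p m (suc N) ∣ ℚ.≤ ι (4 ℕ.* (w ℕ.+ p ℕ.+ 3)) * npow (suc N) 1
error-bound p m N 2≤p = begin
  ∣ lhsT p m (suc N) - rhsT p m (suc N) ∣
    ≡⟨ cong ∣_∣ (error-formula p m (suc N) 2≤p) ⟩
  ∣ D - sgn p * E ∣
    ≤⟨ ∣p-q∣≤∣p∣+∣q∣ D (sgn p * E) ⟩
  ∣ D ∣ + ∣ sgn p * E ∣
    ≡⟨ cong (λ u → ∣ D ∣ + u) (trans (∣p*q∣≡∣p∣*∣q∣ (sgn p) E)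
         (trans (cong (_* ∣ E ∣) (∣sgn∣ p)) (*-identityˡ ∣ E ∣))) ⟩
  ∣ D ∣ + ∣ E ∣
    ≤⟨ +-mono-≤ (T-asymmetry-bound N p w 2≤p 2≤w)
         (∣+∣≤ (∣+∣≤ (∣ι*∣≤ w (E₁-bound N p w 2≤p 2≤w)) (∣ι*∣≤ p (E₁-bound N w p 2≤w 2≤p)))
               (∣+∣≤ (E₂-bound N p w 2≤p 2≤w) (E₂-bound N w p 2≤w 2≤p))) ⟩
  q + ((ι w * q + ι p * q) + (q + q))
    ≡⟨ trans (lem (ι w) (ι p) q) (lem′ (ι 2) r (ι w + ι p + ι 3)) ⟩
  ι 4 * (ι w + ι p + ι 3) * r
    ≡⟨ cong (λ u → ι 4 * u * r) (sym (trans (ι-+ (w ℕ.+ p) 3) (cong (_+ ι 3) (ι-+ w p)))) ⟩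
  ι 4 * ι (w ℕ.+ p ℕ.+ 3) * r
    ≡⟨ cong (_* r) (trans (/-*-/ (+ 4) (+ (w ℕ.+ p ℕ.+ 3)) 1 1) (cong (λ i → i / 1) (sym (ℤ.pos-* 4 (w ℕ.+ p ℕ.+ 3))))) ⟩
  ι (4 ℕ.* (w ℕ.+ p ℕ.+ 3)) * r ∎
  where
  open ≤-Reasoning
  w = p ℕ.+ 2 ℕ.* m ℕ.+ 1
  2≤w : 2 ≤ w
  2≤w = ℕ.≤-trans 2≤p (ℕ.≤-trans (ℕ.m≤m+n p (2 ℕ.* m)) (ℕ.m≤m+n (p ℕ.+ 2 ℕ.* m) 1))
  r = npow (suc N) 1
  q = ι 2 * (ι 2 * r)
  D = T (suc N) w p - T (suc N) p w
  E = (ι w * E₁ (suc N) p w + ι p * E₁ (suc N) w p) + (E₂ (suc N) p w + E₂ (suc N) w p)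
  lem : ∀ W P q → q + ((W * q + P * q) + (q + q)) ≡ q * (W + P + (1ℚ + 1ℚ + 1ℚ))
  lem = solve-∀ ℚ-ring
  lem′ : ∀ x y z → x * (x * y) * z ≡ x * x * z * y
  lem′ = solve-∀ ℚ-ring

-- Passage to the limit

theorem3p1 : ∀ (p m : ℕ) → 2 ≤ p →
    ∀ (ε : ℚ) → 0ℚ < ε →
    ∃[ N₀ ] ∀ (N : ℕ) → N₀ ≤ N → ∣ lhsT p m N - rhsT p m N ∣ < ε
theorem3p1 p m 2≤p ε 0<ε with archimedean (4 ℕ.* ((p ℕ.+ 2 ℕ.* m ℕ.+ 1) ℕ.+ p ℕ.+ 3)) ε 0<ε
-- The error bound is stated at `suc N`, so the threshold is raised by one, which also excludes N =
-- 0.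
... | N₀ , small = suc N₀ , λ where
  (suc N) (s≤s N₀≤N) → ≤-<-trans (error-bound p m N 2≤p) (small N N₀≤N)
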